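{- There exists an absolute constant $c>0$ such that the following holds. Let $H$ be a bipartite graph on $h$ vertices. Then for every sufficiently large $n$ (depending on $H$), every graph $G$ on $n$ vertices which contains no induced subgraph isomorphic to $H$ contains either an independent set of size at least $n^{c/h}$ or a (not necessarily induced) complete bipartite subgraph $K_{m,m}$ with $m\ge n^{c/h}$. -}

module Defs where

open import Data.Nat using (ℕ; _≤_; _^_; _*_)
open import Data.Fin using (Fin)
open import Data.Bool using (Bool; true; false)
open import Data.Product using (Σ; ∃; ∃-syntax; _×_)
open import Relation.Binary.PropositionalEquality using (_≡_; _≢_)
open import Function.Definitions using (Injective)

record Graph (n : ℕ) : Set where
  field
    adj    : Fin n → Fin n → Bool
    sym    : ∀ i j → adj i j ≡ adj j i
    irrefl : ∀ i → adj i i ≡ false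
open Graph public

Bipartite : ∀ {h} → Graph h → Set
Bipartite {h} H = Σ (Fin h → Bool) λ col →
  ∀ i j → adj H i j ≡ true → col i ≢ col j

InducedCopy : ∀ {h n} → Graph h → Graph n → Set
InducedCopy {h} {n} H G = Σ (Fin h → Fin n) λ f →
  Injective _≡_ _≡_ f × (∀ i j → adj G (f i) (f j) ≡ adj H i j)

HasIndependentSet : ∀ {n} → Graph n → ℕ → Set
HasIndependentSet {n} G k = Σ (Fin k → Fin n) λ f →
  Injective _≡_ _≡_ f × (∀ i j → adj G (f i) (f j) ≡ false)

-- G contains K_{m,m} as a (not necessarily induced) subgraph:
-- two injective m-tuples of vertices, every cross pair adjacent
-- (the two sides are automatically disjoint since G is loopless).
HasKmm : ∀ {n} → Graph n → ℕ → Set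
HasKmm {n} G m = Σ (Fin m → Fin n) λ a → Σ (Fin m → Fin n) λ b →
  Injective _≡_ _≡_ a × Injective _≡_ _≡_ b × (∀ i j → adj G (a i) (b j) ≡ true)

{-# OPTIONS --safe #-}

-- Pass to k^(24h) vertices of G, with k as large as possible, and suppose that G has
-- neither an independent k-set nor a K_{k,k}.  Having no independent k-set, G has many vertices of degree
-- at least n/k², so dependent random choice gives a set U of size k^(8h) in which
-- every independent h-tuple has at least k^(8h) common neighbours.  Having no K_{k,k},
-- for each large set C all but k vertices v are non-adjacent to a 1/k² fraction of C
-- (the exceptions are called thin).  An independent h-tuple x of U hosts one class of H.
-- For a vertex of the other class the candidates are obtained from the common
-- neighbours of the prescribed entries of x by imposing the non-adjacencies one by one,
-- losing a factor k² each time unless some entry is thin.  For given other entries at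
-- most k values of an entry are thin, while the number of independent h-tuples of U
-- exceeds the number of independent (h-1)-tuples by a factor k³ > h²k: the ratios of
-- consecutive counts drop by at most k³, by Cauchy–Schwarz.  So some x has no thin
-- entry, every candidate set has size at least k^(2h+2), and the other class is
-- chosen greedily.
module Submission where

open import Defs
open import Data.Nat using (ℕ; _≤_; _^_; _*_)
open import Data.Product using (Σ; ∃; ∃-syntax; _×_)
open import Data.Sum using (_⊎_)
open import Relation.Nullary using (¬_)

open import Data.Bool using (Bool; true; false; _∧_; not; if_then_else_)
open import Data.Bool.Properties using () renaming (_≟_ to _≟ᵇ_)
open import Data.Empty using (⊥)
open import Data.Fin using (Fin; zero; suc; inject≤; finToFun; funToFin; _≟_)
open import Data.Fin.Properties
  using (suc-injective; inject≤-injective; any?; all?; finToFun-funToFin)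
open import Data.Nat using (zero; suc; _+_; _∸_; _<_; z≤n; s≤s; NonZero; >-nonZero; _<?_; _≤?_)
open import Data.Nat.Properties hiding (suc-injective)
  renaming (_≟_ to _≟ⁿ_)
open import Algebra.Properties.Semiring.Sum +-*-semiring
  using (sum; sum-cong-≗; ∑-distrib-+; ∑-comm; *-distribˡ-sum; *-distribʳ-sum)
open import Data.Nat.Tactic.RingSolver using (solve-∀)
open import Data.Product using (_,_; proj₁; proj₂)
open import Data.Sum using (inj₁; inj₂) renaming (map to map-⊎)
open import Data.Unit using (⊤; tt)
open import Data.Vec using (Vec; []; _∷_; lookup; tabulate)
open import Data.Vec.Properties using (lookup∘tabulate)
open import Function using (_∘_)
open import Function.Definitions using (Injective)
open import Relation.Binary.PropositionalEquality
  using (_≡_; _≢_; refl; trans; cong; cong₂; subst₂)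
  renaming (sym to ≡-sym)
open import Relation.Nullary using (Dec; yes; no; ⌊_⌋; contradiction)
open import Relation.Nullary.Decidable using (map′; _×-dec_; _→-dec_)

private variable
  n p : ℕ

-- Finite sums

sum-mono : {f g : Fin n → ℕ} → (∀ i → f i ≤ g i) → sum f ≤ sum g
sum-mono {zero}  f≤g = z≤n
sum-mono {suc n} f≤g = +-mono-≤ (f≤g zero) (sum-mono (f≤g ∘ suc))

sum-const : ∀ n c → sum {n} (λ _ → c) ≡ n * c
sum-const zero    c = refl
sum-const (suc n) c = cong (c +_) (sum-const n c)

-- The averaging principle. It takes the place of expectations: every vertex or tuple found below by
-- counting comes from a strict inequality between two sums.
sum-<⇒∃ : {f g : Fin n → ℕ} → sum f < sum g → ∃[ i ] f i < g i
sum-<⇒∃ {suc n} {f} {g} lt with f zero <? g zero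
... | yes f₀<g₀ = zero , f₀<g₀
... | no  f₀≮g₀ =
  let i , fi<gi = sum-<⇒∃ (+-cancelˡ-< (f zero) _ _
                    (<-≤-trans lt (+-monoˡ-≤ (sum (g ∘ suc)) (≮⇒≥ f₀≮g₀))))
  in suc i , fi<gi

term≤sum : (f : Fin n → ℕ) (i : Fin n) → f i ≤ sum f
term≤sum f zero    = m≤m+n _ _
term≤sum f (suc i) = ≤-trans (term≤sum (f ∘ suc) i) (m≤n+m _ _)

𝟙 : Bool → ℕ
𝟙 true  = 1
𝟙 false = 0

𝟙≤1 : ∀ b → 𝟙 b ≤ 1
𝟙≤1 true  = ≤-refl
𝟙≤1 false = z≤n

<𝟙⇒true : ∀ {m b} → m < 𝟙 b → b ≡ true
<𝟙⇒true {b = true} _ = refl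

𝟙<1⇒false : ∀ {b} → 𝟙 b < 1 → b ≡ false
𝟙<1⇒false {false} _ = refl
𝟙<1⇒false {true} (s≤s ())

∧-intro : ∀ {a b} → a ≡ true → b ≡ true → a ∧ b ≡ true
∧-intro refl refl = refl

∧-elim : ∀ a {b} → a ∧ b ≡ true → a ≡ true × b ≡ true
∧-elim true eq = refl , eq

-- Vertex subsets as Boolean predicates

Sub : ℕ → Set
Sub n = Fin n → Bool

infixr 7 _∩_
infix  4 _⊆_

_∩_ : Sub n → Sub n → Sub n
(S ∩ T) v = S v ∧ T v

_⊆_ : Sub n → Sub n → Set
S ⊆ T = ∀ v → S v ≡ true → T v ≡ true

full : Sub n
full _ = true

card : Sub n → ℕ
card S = sum (λ v → 𝟙 (S v))

𝟙-mono : ∀ {a b} → (a ≡ true → b ≡ true) → 𝟙 a ≤ 𝟙 b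
𝟙-mono {false} a⇒b = z≤n
𝟙-mono {true}  a⇒b rewrite a⇒b refl = ≤-refl

card-mono : {S T : Sub n} → S ⊆ T → card S ≤ card T
card-mono S⊆T = sum-mono (λ v → 𝟙-mono (S⊆T v))

card-full : ∀ n → card {n} full ≡ n
card-full n = trans (sum-const n 1) (*-identityʳ n)

card≤n : (S : Sub n) → card S ≤ n
card≤n {n} S = ≤-trans (card-mono {S = S} {full} (λ _ _ → refl)) (≤-reflexive (card-full n))

∩-monoˡ : {S T R : Sub n} → S ⊆ T → S ∩ R ⊆ T ∩ R
∩-monoˡ {S = S} S⊆T v eq = let s , r = ∧-elim (S v) eq in ∧-intro (S⊆T v s) r

∩-swapʳ : (S T R : Sub n) → (S ∩ T) ∩ R ⊆ (S ∩ R) ∩ T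
∩-swapʳ S T R v eq =
  let ST , r = ∧-elim (S v ∧ T v) eq
      s , t = ∧-elim (S v) ST
  in ∧-intro (∧-intro s r) t

card-sum : (f : Fin p → Sub n) →
           sum (λ v → sum (λ i → 𝟙 (f i v))) ≡ sum (λ i → card (f i))
card-sum f = ∑-comm (λ v i → 𝟙 (f i v))

inject-into : (S : Sub n) (k : ℕ) → k ≤ card S →
  Σ (Fin k → Fin n) λ f → Injective _≡_ _≡_ f × (∀ i → S (f i) ≡ true)
inject-into S zero _ = (λ ()) , (λ {}) , λ ()
inject-into {suc n} S (suc k) k<S with S zero in eq
... | false =
  let f , inj , f∈S = inject-into (S ∘ suc) (suc k) k<S
  in suc ∘ f , inj ∘ suc-injective , f∈S
... | true = f′ , inj′ , f′∈S
  where
  rec = inject-into (S ∘ suc) k (≤-pred k<S)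
  f′ : Fin (suc k) → Fin (suc n)
  f′ zero    = zero
  f′ (suc i) = suc (proj₁ rec i)
  inj′ : Injective _≡_ _≡_ f′
  inj′ {zero}  {zero}  _ = refl
  inj′ {suc i} {suc j} e = cong suc (proj₁ (proj₂ rec) (suc-injective e))
  f′∈S : ∀ i → S (f′ i) ≡ true
  f′∈S zero    = eq
  f′∈S (suc i) = proj₂ (proj₂ rec) i

card-singleton : (v : Fin n) → card (λ w → ⌊ v ≟ w ⌋) ≤ 1
card-singleton v = ≮⇒≥ λ 1<c →
  let f , inj , f∈ = inject-into (λ w → ⌊ v ≟ w ⌋) 2 1<c
  in contradiction (inj {zero} {suc zero} (trans (≡-sym (is-v (f∈ zero))) (is-v (f∈ (suc zero))))) λ ()
  where
  is-v : ∀ {w} → ⌊ v ≟ w ⌋ ≡ true → v ≡ w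
  is-v {w} _ with yes eq ← v ≟ w = eq

-- Weighted sums over independent tuples

module Tuples (G : Graph n) where

  Nb : Fin n → Sub n
  Nb v w = adj G v w

  -- Non-neighbours are distinct from v, so that tuples of pairwise
  -- non-neighbours are injective.
  Non : Fin n → Sub n
  Non v w = not (adj G v w) ∧ not ⌊ v ≟ w ⌋

  -- The tuples are ordered. Independence is enforced by shrinking the ambient set to the
  -- non-neighbours of each chosen entry, so that statements about tuples go by induction on `p`
  -- with `U` varying.
  ∑ind : ∀ p → Sub n → (Vec (Fin n) p → ℕ) → ℕ
  ∑ind zero    U F = F []
  ∑ind (suc p) U F = sum λ v → 𝟙 (U v) * ∑ind p (U ∩ Non v) (λ x → F (v ∷ x))

  #ind : ℕ → Sub n → ℕ
  #ind p U = ∑ind p U (λ _ → 1)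

  IndepIn : Sub n → Vec (Fin n) p → Set
  IndepIn U []      = ⊤
  IndepIn U (v ∷ x) = U v ≡ true × IndepIn (U ∩ Non v) x

  all-in : Sub n → Vec (Fin n) p → Bool
  all-in W []      = true
  all-in W (v ∷ x) = W v ∧ all-in W x

  ∑ind-mono : {U U′ : Sub n} {F F′ : Vec (Fin n) p → ℕ} → U ⊆ U′ →
              (∀ x → F x ≤ F′ x) → ∑ind p U F ≤ ∑ind p U′ F′
  ∑ind-mono {zero}  U⊆U′ F≤F′ = F≤F′ []
  ∑ind-mono {suc p} {U} {U′} U⊆U′ F≤F′ = sum-mono λ v →
    *-mono-≤ (𝟙-mono (U⊆U′ v))
             (∑ind-mono (∩-monoˡ {S = U} {U′} {Non v} U⊆U′) (λ x → F≤F′ (v ∷ x)))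

  ∑ind-+ : (U : Sub n) (F F′ : Vec (Fin n) p → ℕ) →
           ∑ind p U (λ x → F x + F′ x) ≡ ∑ind p U F + ∑ind p U F′
  ∑ind-+ {zero}  U F F′ = refl
  ∑ind-+ {suc p} U F F′ = trans
    (sum-cong-≗ λ v → trans (cong (𝟙 (U v) *_) (∑ind-+ {p} (U ∩ Non v) (λ x → F (v ∷ x)) _))
                            (*-distribˡ-+ (𝟙 (U v)) _ _))
    (∑-distrib-+ {n} _ _)

  ∑ind-* : (U : Sub n) (c : ℕ) (F : Vec (Fin n) p → ℕ) →
           ∑ind p U (λ x → c * F x) ≡ c * ∑ind p U F
  ∑ind-* {zero}  U c F = refl
  ∑ind-* {suc p} U c F = trans
    (sum-cong-≗ λ v → trans (cong (𝟙 (U v) *_) (∑ind-* {p} (U ∩ Non v) c (λ x → F (v ∷ x))))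
                            (swap (𝟙 (U v)) c _))
    (≡-sym (*-distribˡ-sum {n} c _))
    where
    swap : ∀ a b c → a * (b * c) ≡ b * (a * c)
    swap = solve-∀

  ∑ind-const : (U : Sub n) (c : ℕ) → ∑ind p U (λ _ → c) ≡ c * #ind p U
  ∑ind-const {p} U c = trans (cong (λ c → ∑ind p U (λ _ → c)) (≡-sym (*-identityʳ c)))
                             (∑ind-* {p} U c (λ _ → 1))

  ∑ind-sum : ∀ {m} (U : Sub n) (F : Fin m → Vec (Fin n) p → ℕ) →
             ∑ind p U (λ x → sum (λ j → F j x)) ≡ sum (λ j → ∑ind p U (F j))
  ∑ind-sum {zero}  U F = refl
  ∑ind-sum {suc p} {m} U F = trans
    (sum-cong-≗ λ v → trans (cong (𝟙 (U v) *_) (∑ind-sum (U ∩ Non v) (λ j x → F j (v ∷ x))))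
                            (*-distribˡ-sum {m} (𝟙 (U v)) _))
    (∑-comm {n} {m} _)

  ∑ind-<⇒∃ : (U : Sub n) {F F′ : Vec (Fin n) p → ℕ} → ∑ind p U F < ∑ind p U F′ →
             ∃[ x ] IndepIn U x × F x < F′ x
  ∑ind-<⇒∃ {zero}  U lt = [] , tt , lt
  ∑ind-<⇒∃ {suc p} U lt with sum-<⇒∃ {n} lt
  ... | v , lt′ with U v in eq
  ... | true =
    let x , ind , Fx<F′x = ∑ind-<⇒∃ (U ∩ Non v) (+-cancelʳ-< 0 _ _ lt′)
    in v ∷ x , (eq , ind) , Fx<F′x

  -- Moves the restriction to `W` from the ambient set into the weight; a sum over many sets `W` can
  -- then be exchanged with the sum over tuples.
  ∑ind-∩ : (U W : Sub n) (F : Vec (Fin n) p → ℕ) →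
           ∑ind p (U ∩ W) F ≤ ∑ind p U (λ x → 𝟙 (all-in W x) * F x)
  ∑ind-∩ {zero}  U W F = ≤-reflexive (≡-sym (+-identityʳ _))
  ∑ind-∩ {suc p} U W F = sum-mono step
    where
    step : ∀ v → 𝟙 (U v ∧ W v) * ∑ind p ((U ∩ W) ∩ Non v) (λ x → F (v ∷ x)) ≤
                 𝟙 (U v) * ∑ind p (U ∩ Non v) (λ x → 𝟙 (W v ∧ all-in W x) * F (v ∷ x))
    step v with U v | W v
    ... | false | _     = z≤n
    ... | true  | false = z≤n
    ... | true  | true  = *-monoʳ-≤ 1 (≤-trans
      (∑ind-mono {p} (∩-swapʳ U W (Non v)) (λ _ → ≤-refl))
      (∑ind-∩ (U ∩ Non v) W (λ x → F (v ∷ x))))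

  #ind≤n^p : ∀ p (U : Sub n) → #ind p U ≤ n ^ p
  #ind≤n^p zero    U = ≤-refl
  #ind≤n^p (suc p) U = ≤-trans
    (sum-mono λ v → ≤-trans (*-mono-≤ (𝟙≤1 (U v)) (#ind≤n^p p (U ∩ Non v)))
                            (≤-reflexive (*-identityˡ _)))
    (≤-reflexive (sum-const n (n ^ p)))

  Non⇒ : ∀ {v w} → Non v w ≡ true → adj G v w ≡ false × v ≢ w
  Non⇒ {v} {w} e with adj G v w | v ≟ w
  ... | false | no v≢w = refl , v≢w

  common : Vec (Fin n) p → Sub n
  common x w = all-in (Nb w) x

  -- Dependent random choice

  module DependentRandomChoice (s : ℕ) where

    poor : Vec (Fin n) p → ℕ
    poor x = 𝟙 ⌊ card (common x) <? s ⌋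

    #poor : ℕ → Sub n → ℕ
    #poor p U = ∑ind p U poor

    -- A poor `x` lies inside `Nb w` only if `w` is one of its fewer than `s` common neighbours, so
    -- it is counted at most `s` times on the left.
    sum-#poor : ∀ p (U : Sub n) → sum (λ w → #poor p (U ∩ Nb w)) ≤ s * #poor p U
    sum-#poor p U = begin
      sum (λ w → #poor p (U ∩ Nb w))
        ≤⟨ sum-mono (λ w → ∑ind-∩ {p} U (Nb w) poor) ⟩
      sum (λ w → ∑ind p U (λ x → 𝟙 (common x w) * poor x))
        ≡⟨ ∑ind-sum {p} U (λ w x → 𝟙 (common x w) * poor x) ⟨
      ∑ind p U (λ x → sum (λ w → 𝟙 (common x w) * poor x))
        ≤⟨ ∑ind-mono {p} (λ _ e → e) pointwise ⟩
      ∑ind p U (λ x → s * poor x)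
        ≡⟨ ∑ind-* {p} U s poor ⟩
      s * #poor p U ∎
      where
      open ≤-Reasoning
      pointwise : (x : Vec (Fin n) p) → sum (λ w → 𝟙 (common x w) * poor x) ≤ s * poor x
      pointwise x = ≤-trans
        (≤-reflexive (≡-sym (*-distribʳ-sum {n} (poor x) (λ w → 𝟙 (common x w))))) bound
        where
        bound : card (common x) * poor x ≤ s * poor x
        bound with card (common x) <? s
        ... | yes c<s = *-monoˡ-≤ 1 (<⇒≤ c<s)
        ... | no  _   = ≤-reflexive (trans (*-zeroʳ (card (common x))) (≡-sym (*-zeroʳ s)))

    MinDegree : ℕ → Sub n → Set
    MinDegree d U = ∀ v → U v ≡ true → d ≤ card (Nb v)

    sum-card-∩ : ∀ {d} (U : Sub n) → MinDegree d U →
                 d * card U ≤ sum (λ w → card (U ∩ Nb w))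
    sum-card-∩ {d} U deg = begin
      d * card U                               ≡⟨ *-distribˡ-sum {n} d _ ⟩
      sum (λ v → d * 𝟙 (U v))                  ≤⟨ sum-mono pointwise ⟩
      sum (λ v → sum (λ w → 𝟙 ((U ∩ Nb w) v))) ≡⟨ ∑-comm {n} {n} _ ⟩
      sum (λ w → card (U ∩ Nb w))              ∎
      where
      open ≤-Reasoning
      pointwise : ∀ v → d * 𝟙 (U v) ≤ sum (λ w → 𝟙 (U v ∧ adj G w v))
      pointwise v with U v in eq
      ... | false = ≤-trans (≤-reflexive (*-zeroʳ d)) z≤n
      ... | true  = ≤-trans (≤-reflexive (*-identityʳ d)) (≤-trans (deg v eq)
                      (≤-reflexive (sum-cong-≗ (λ w → cong 𝟙 (adj-sym v w)))))
        where adj-sym = Graph.sym G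

    sum-affine : ∀ a b (f : Fin n → ℕ) → sum (λ w → a + b * f w) ≡ n * a + b * sum f
    sum-affine a b f = trans (∑-distrib-+ {n} _ _)
      (cong₂ _+_ (sum-const n a) (≡-sym (*-distribˡ-sum {n} b f)))

    -- One random step, derandomised. For a random `w`, the expected size of `U ∩ Nb w` is at least
    -- `d / n` times that of `U`, and the expected number of poor tuples at most `s / n` times the
    -- old one. Some `w` is no worse than average for the combination weighted by `α` and `β`;
    -- subtracted terms stand on the opposite side.
    restrict-once : ∀ {d} p (U : Sub n) (α β : ℕ) → 1 ≤ n → MinDegree d U →
      ∃[ w ] α * (d * card U) + n * β * #poor p (U ∩ Nb w) ≤
             β * (s * #poor p U) + n * α * card (U ∩ Nb w)
    restrict-once {d} p U α β 1≤n deg =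
      let w , lt = sum-<⇒∃ {n} (begin-strict
            sum (λ w → A + n * β * P w)
              ≡⟨ sum-affine A (n * β) P ⟩
            n * A + n * β * sum P
              ≤⟨ +-mono-≤ (*-monoʳ-≤ n (*-monoʳ-≤ α (sum-card-∩ U deg)))
                          (*-monoʳ-≤ (n * β) (sum-#poor p U)) ⟩
            n * (α * sum C) + n * β * (s * #poor p U)
              ≡⟨ rearrange n α β (sum C) (s * #poor p U) ⟩
            n * B + n * α * sum C
              -- Averaging needs a strict inequality; the `suc` inserted here is removed again by
              -- `≤-pred`.
              <⟨ +-monoˡ-< (n * α * sum C) (*-monoʳ-< n {{>-nonZero 1≤n}} (n<1+n B)) ⟩
            n * suc B + n * α * sum C
              ≡⟨ sum-affine (suc B) (n * α) C ⟨
            sum (λ w → suc B + n * α * C w) ∎)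
      in w , ≤-pred lt
      where
      open ≤-Reasoning
      A = α * (d * card U)
      B = β * (s * #poor p U)
      C = λ w → card (U ∩ Nb w)
      P = λ w → #poor p (U ∩ Nb w)
      rearrange : ∀ n α β c q → n * (α * c) + n * β * q ≡ n * (β * q) + n * α * c
      rearrange = solve-∀

    -- With subtraction this reads: `n ^ t` times `α * card U′ - β * #poor p U′` is at least `α * d
    -- ^ t * card U - β * s ^ t * #poor p
    -- U`. The set `U′` is cut out of `U` by the neighbourhoods of `t` vertices.
    restrict : ∀ {d} p t (U : Sub n) (α β : ℕ) → 1 ≤ n → MinDegree d U →
      ∃[ U′ ] α * (d ^ t * card U) + n ^ t * β * #poor p U′ ≤
              β * (s ^ t * #poor p U) + n ^ t * α * card U′
    restrict p zero U α β _ _ = U , ≤-reflexive (base α β (card U) (#poor p U))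
      where
      base : ∀ α β c q → α * (1 * c) + 1 * β * q ≡ β * (1 * q) + 1 * α * c
      base = solve-∀
    restrict {d} p (suc t) U α β 1≤n deg =
      -- The weights anticipate the factors of the remaining `t` steps, so the terms in `c` and `q`
      -- cancel when the two inequalities are added.
      let w  , once = restrict-once p U (α * d ^ t) (β * s ^ t) 1≤n deg
          U′ , rest = restrict p t (U ∩ Nb w) α β 1≤n
                        (λ v v∈ → deg v (proj₁ (∧-elim (U v) v∈)))
          c = card (U ∩ Nb w)
          q = #poor p (U ∩ Nb w)
      in U′ , +-cancelʳ-≤ (n * (α * d ^ t) * c + n * (β * s ^ t) * q) _ _
           (subst₂ _≤_
             (lhs α β d (d ^ t) (s ^ t) n (n ^ t) (card U) c q (#poor p U′))
             (rhs α β s (d ^ t) (s ^ t) n (n ^ t) (#poor p U) c q (card U′))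
             (+-mono-≤ once (*-monoʳ-≤ n rest)))
      where
      lhs : ∀ α β d dt st n nt u c q q′ →
        (α * dt * (d * u) + n * (β * st) * q) + n * (α * (dt * c) + nt * β * q′) ≡
        (α * (d * dt * u) + n * nt * β * q′) + (n * (α * dt) * c + n * (β * st) * q)
      lhs = solve-∀
      rhs : ∀ α β s dt st n nt r c q u′ →
        (β * st * (s * r) + n * (α * dt) * c) + n * (β * (st * q) + nt * α * u′) ≡
        (β * (s * st * r) + n * nt * α * u′) + (n * (α * dt) * c + n * (β * st) * q)
      rhs = solve-∀

  -- Set differences, greedy independent sets, intersections

  card-∖Nb : (C : Sub n) (v : Fin n) →
             card (λ w → C w ∧ not (adj G v w)) ≤ card (C ∩ Non v) + 1
  card-∖Nb C v = ≤-trans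
    (sum-mono λ w → pointwise (C w) (adj G v w) ⌊ v ≟ w ⌋)
    (≤-trans (≤-reflexive (∑-distrib-+ {n} _ _))
             -- The extra 1 pays for `v` itself, which is not adjacent to `v` but is excluded from
             -- `Non v`.
             (+-monoʳ-≤ (card (C ∩ Non v)) (card-singleton v)))
    where
    pointwise : ∀ c a e → 𝟙 (c ∧ not a) ≤ 𝟙 (c ∧ (not a ∧ not e)) + 𝟙 e
    pointwise false a     e     = z≤n
    pointwise true  true  e     = z≤n
    pointwise true  false false = ≤-refl
    pointwise true  false true  = ≤-refl

  card-split : (C D : Sub n) → card C ≤ card (C ∩ D) + card (λ w → C w ∧ not (D w))
  card-split C D = ≤-trans
    (sum-mono λ w → pointwise (C w) (D w)) (≤-reflexive (∑-distrib-+ {n} _ _))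
    where
    pointwise : ∀ c d → 𝟙 c ≤ 𝟙 (c ∧ d) + 𝟙 (c ∧ not d)
    pointwise false d     = z≤n
    pointwise true  true  = ≤-refl
    pointwise true  false = ≤-refl

  -- Choosing `v` costs `L` at most `d` vertices: its fewer than `d` neighbours and `v` itself.
  greedy-independent : ∀ k {d} → 1 ≤ d → (L : Sub n) →
    (∀ v → L v ≡ true → card (Nb v) < d) → k * d ≤ card L →
    Σ (Fin k → Fin n) λ f → (∀ i → L (f i) ≡ true) ×
      Injective _≡_ _≡_ f × (∀ i j → adj G (f i) (f j) ≡ false)
  greedy-independent zero _ L _ _ = (λ ()) , (λ ()) , (λ {}) , λ ()
  greedy-independent (suc k) {d} 1≤d L low big = f′ , f′∈L , inj′ , indep′
    where
    v₀ = inject-into L 1 (≤-trans 1≤d (≤-trans (m≤m+n d (k * d)) big))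
    v = proj₁ v₀ zero
    v∈L = proj₂ (proj₂ v₀) zero
    shrink : k * d ≤ card (L ∩ Non v)
    shrink = +-cancelˡ-≤ d _ _ (begin
      d + k * d                                        ≤⟨ big ⟩
      card L                                           ≤⟨ card-split L (Nb v) ⟩
      card (L ∩ Nb v) + card (λ w → L w ∧ not (Nb v w))
        ≤⟨ +-mono-≤ (card-mono {S = L ∩ Nb v} {Nb v} (λ w e → proj₂ (∧-elim (L w) e)))
                    (card-∖Nb L v) ⟩
      card (Nb v) + (card (L ∩ Non v) + 1)             ≡⟨ shift (card (Nb v)) _ ⟩
      suc (card (Nb v)) + card (L ∩ Non v)             ≤⟨ +-monoˡ-≤ _ (low v v∈L) ⟩
      d + card (L ∩ Non v)                             ∎)
      where
      open ≤-Reasoning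
      shift : ∀ a b → a + (b + 1) ≡ suc a + b
      shift = solve-∀
    rec = greedy-independent k 1≤d (L ∩ Non v)
            (λ w w∈ → low w (proj₁ (∧-elim (L w) w∈))) shrink
    f = proj₁ rec
    f∈ = proj₁ (proj₂ rec)
    f-non : ∀ i → adj G v (f i) ≡ false × v ≢ f i
    f-non i = Non⇒ (proj₂ (∧-elim (L (f i)) (f∈ i)))
    f′ : Fin (suc k) → Fin n
    f′ zero    = v
    f′ (suc i) = f i
    f′∈L : ∀ i → L (f′ i) ≡ true
    f′∈L zero    = v∈L
    f′∈L (suc i) = proj₁ (∧-elim (L (f i)) (f∈ i))
    inj′ : Injective _≡_ _≡_ f′
    inj′ {zero}  {zero}  e = refl
    inj′ {zero}  {suc j} e = contradiction e (proj₂ (f-non j))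
    inj′ {suc i} {zero}  e = contradiction (≡-sym e) (proj₂ (f-non i))
    inj′ {suc i} {suc j} e = cong suc (proj₁ (proj₂ (proj₂ rec)) e)
    indep′ : ∀ i j → adj G (f′ i) (f′ j) ≡ false
    indep′ zero    zero    = irrefl G v
    indep′ zero    (suc j) = proj₁ (f-non j)
    indep′ (suc i) zero    = trans (Graph.sym G (f i) v) (proj₁ (f-non i))
    indep′ (suc i) (suc j) = proj₂ (proj₂ (proj₂ rec)) i j

  ⋂ : ∀ {m} → (Fin m → Sub n) → Sub n
  ⋂ {zero}  a w = true
  ⋂ {suc m} a w = a zero w ∧ ⋂ (a ∘ suc) w

  ⋂-⊆ : ∀ {m} (a : Fin m → Sub n) i → ⋂ a ⊆ a i
  ⋂-⊆ a zero    w e = proj₁ (∧-elim (a zero w) e)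
  ⋂-⊆ a (suc i) w e = ⋂-⊆ (a ∘ suc) i w (proj₂ (∧-elim (a zero w) e))

  -- Union bound: a vertex of `C` outside the intersection misses some `a i`.
  card-⋂ : ∀ {m} (C : Sub n) (a : Fin m → Sub n) →
           card C ≤ card (C ∩ ⋂ a) + sum (λ i → card (λ w → C w ∧ not (a i w)))
  card-⋂ {zero} C a = ≤-trans
    (card-mono {S = C} {C ∩ ⋂ a} (λ w e → ∧-intro e refl)) (m≤m+n _ _)
  card-⋂ {suc m} C a = begin
    card C
      ≤⟨ card-split C (a zero) ⟩
    card (C ∩ a zero) + z
      ≤⟨ +-monoˡ-≤ z (card-⋂ (C ∩ a zero) (a ∘ suc)) ⟩
    card ((C ∩ a zero) ∩ ⋂ (a ∘ suc)) + sum (λ i → card (λ w → (C w ∧ a zero w) ∧ not (a (suc i) w))) + z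
      ≤⟨ +-monoˡ-≤ z (+-mono-≤
           (card-mono {S = (C ∩ a zero) ∩ ⋂ (a ∘ suc)} {C ∩ ⋂ a} assoc)
           (sum-mono (λ i → card-mono
             {S = λ w → (C w ∧ a zero w) ∧ not (a (suc i) w)}
             {λ w → C w ∧ not (a (suc i) w)} (drop i)))) ⟩
    card (C ∩ ⋂ a) + sum (λ i → card (λ w → C w ∧ not (a (suc i) w))) + z
      ≡⟨ +-assoc (card (C ∩ ⋂ a)) _ z ⟩
    card (C ∩ ⋂ a) + (sum (λ i → card (λ w → C w ∧ not (a (suc i) w))) + z)
      ≡⟨ cong (card (C ∩ ⋂ a) +_) (+-comm _ z) ⟩
    card (C ∩ ⋂ a) + (z + sum (λ i → card (λ w → C w ∧ not (a (suc i) w)))) ∎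
    where
    open ≤-Reasoning
    z = card (λ w → C w ∧ not (a zero w))
    assoc : (C ∩ a zero) ∩ ⋂ (a ∘ suc) ⊆ C ∩ ⋂ a
    assoc w e = let ca , r = ∧-elim (C w ∧ a zero w) e
                    c , a₀ = ∧-elim (C w) ca
                in ∧-intro c (∧-intro a₀ r)
    drop : ∀ i w → (C w ∧ a zero w) ∧ not (a (suc i) w) ≡ true → C w ∧ not (a (suc i) w) ≡ true
    drop i w e = let ca , r = ∧-elim (C w ∧ a zero w) e
                 in ∧-intro (proj₁ (∧-elim (C w) ca)) r

  -- Graphs without K_{k,k}

  module NoLargeBiclique (k : ℕ) (4≤k : 4 ≤ k) (no-Kkk : ¬ HasKmm G k) where

    1≤k : 1 ≤ k
    1≤k = ≤-trans (s≤s z≤n) 4≤k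

    -- The first conjunct means that a small `C` has no thin vertices, which lets `few-thin` hold
    -- for every `C`.
    thin : Sub n → Sub n
    thin C v = ⌊ k * k ≤? card C ⌋ ∧ ⌊ k * k * card (C ∩ Non v) <? card C ⌋

    thin⇒ : ∀ C {v} → thin C v ≡ true → k * k ≤ card C × k * k * card (C ∩ Non v) < card C
    thin⇒ C {v} e with k * k ≤? card C | k * k * card (C ∩ Non v) <? card C
    ... | yes p | yes q = p , q

    -- Imposing a non-adjacency costs 2 in the exponent of `k`.
    ¬thin⇒ : ∀ C {v} e → thin C v ≡ false → k ^ (2 + e) ≤ card C → k ^ e ≤ card (C ∩ Non v)
    ¬thin⇒ C {v} e eq big with k * k ≤? card C | k * k * card (C ∩ Non v) <? card C
    ... | no kk≰C | _ = contradiction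
      (≤-trans (*-monoʳ-≤ k (m≤m*n k (k ^ e) {{m^n≢0 k e {{>-nonZero 1≤k}}}})) big) kk≰C
    ... | yes _ | no ≮C = *-cancelˡ-≤ (k * k) {{>-nonZero (*-mono-≤ 1≤k 1≤k)}}
      (≤-trans (≤-reflexive (*-assoc k k (k ^ e))) (≤-trans big (≮⇒≥ ≮C)))

    -- k thin vertices together miss at most half of C, and what they all see is
    -- the other side of a K_{k,k}.
    few-thin : ∀ C → card (thin C) ≤ k
    few-thin C = ≮⇒≥ λ k<thin →
      let a , inj , a∈ = inject-into (thin C) k (<⇒≤ k<thin)
      in biclique a inj (λ i → proj₁ (thin⇒ C (a∈ i))) (λ i → proj₂ (thin⇒ C (a∈ i)))
      where
      biclique : (a : Fin k → Fin n) → Injective _≡_ _≡_ a → (Fin k → k * k ≤ card C) →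
                 (∀ i → k * k * card (C ∩ Non (a i)) < card C) → ⊥
      biclique a inj kk≤ thin-a with k ≤? card (C ∩ ⋂ (λ i → Nb (a i)))
      ... | yes k≤Y =
        let b , inj-b , b∈ = inject-into (C ∩ ⋂ (λ i → Nb (a i))) k k≤Y
        in no-Kkk (a , b , inj , inj-b , λ i j →
             ⋂-⊆ (λ i → Nb (a i)) i (b j) (proj₂ (∧-elim (C (b j)) (b∈ j))))
      -- Now `k * y ≤ k * k ≤ c`, and each `k * k * z i ≤ 2 * c`, one `c` coming from thinness and
      -- the other covering `a i` itself. Hence `k * k * c ≤ 3 * k * c`, contradicting `4 ≤ k`.
      ... | no k≰Y = <-irrefl refl (begin-strict
          k * (k * c)             ≤⟨ *-monoʳ-≤ k (*-monoʳ-≤ k (card-⋂ C (λ i → Nb (a i)))) ⟩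
          k * (k * (y + sum z))   ≡⟨ split k y (sum z) ⟩
          k * (k * y) + k * k * sum z
            ≤⟨ +-mono-≤ (*-monoʳ-≤ k (*-monoʳ-≤ k (<⇒≤ (≰⇒> k≰Y)))) missed ⟩
          k * (k * k) + k * (2 * c)
            ≤⟨ +-monoˡ-≤ _ (*-monoʳ-≤ k kk≤c) ⟩
          k * c + k * (2 * c)     ≡⟨ collect k c ⟩
          k * (3 * c)             <⟨ *-monoʳ-< k {{>-nonZero 1≤k}}
                                       (*-monoˡ-< c {{>-nonZero c≥1}} 4≤k) ⟩
          k * (k * c)             ∎)
        where
        open ≤-Reasoning
        c = card C
        y = card (C ∩ ⋂ (λ i → Nb (a i)))
        z : Fin k → ℕ
        z i = card (λ w → C w ∧ not (Nb (a i) w))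
        kk≤c : k * k ≤ c
        kk≤c = kk≤ (inject≤ zero 1≤k)
        c≥1 : 1 ≤ c
        c≥1 = ≤-trans (*-mono-≤ 1≤k 1≤k) kk≤c
        z-bound : ∀ i → k * k * z i ≤ 2 * c
        z-bound i = begin
          k * k * z i                           ≤⟨ *-monoʳ-≤ (k * k) (card-∖Nb C (a i)) ⟩
          k * k * (card (C ∩ Non (a i)) + 1)    ≡⟨ expand (k * k) _ ⟩
          k * k * card (C ∩ Non (a i)) + k * k  ≤⟨ +-mono-≤ (<⇒≤ (thin-a i)) kk≤c ⟩
          c + c                                 ≡⟨ double c ⟩
          2 * c                                 ∎
          where
          expand : ∀ q x → q * (x + 1) ≡ q * x + q
          expand = solve-∀
          double : ∀ x → x + x ≡ 2 * x
          double = solve-∀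
        missed : k * k * sum z ≤ k * (2 * c)
        missed = begin
          k * k * sum z             ≡⟨ *-distribˡ-sum {k} (k * k) z ⟩
          sum (λ i → k * k * z i)   ≤⟨ sum-mono z-bound ⟩
          sum {k} (λ i → 2 * c)     ≡⟨ sum-const k (2 * c) ⟩
          k * (2 * c)               ∎
        split : ∀ k y z → k * (k * (y + z)) ≡ k * (k * y) + k * k * z
        split = solve-∀
        collect : ∀ k c → k * c + k * (2 * c) ≡ k * (3 * c)
        collect = solve-∀

    -- Growth of the number of independent tuples

    #ind1 : ∀ E → #ind 1 E ≡ card E
    #ind1 E = sum-cong-≗ (λ v → *-identityʳ (𝟙 (E v)))

    -- Each non-thin `v` in a large `E` has at least `card E / k²` non-neighbours there, and at most
    -- `k` vertices are thin. If `card E < k²`, the term `#ind 1 E` suffices alone.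
    card²≤#ind : ∀ E → card E * card E ≤ k * k * (#ind 2 E + #ind 1 E)
    card²≤#ind E with k * k ≤? card E
    ... | no kk≰ = begin
          card E * card E               ≤⟨ *-monoˡ-≤ (card E) (<⇒≤ (≰⇒> kk≰)) ⟩
          k * k * card E                ≡⟨ cong (k * k *_) (#ind1 E) ⟨
          k * k * #ind 1 E              ≤⟨ *-monoʳ-≤ (k * k) (m≤n+m _ _) ⟩
          k * k * (#ind 2 E + #ind 1 E) ∎
      where open ≤-Reasoning
    ... | yes kk≤ = begin
          e * e                                         ≡⟨ *-distribʳ-sum {n} e _ ⟩
          sum (λ v → 𝟙 (E v) * e)                       ≤⟨ sum-mono pointwise ⟩
          sum (λ v → k * k * two v + e * 𝟙 (thin E v))  ≡⟨ ∑-distrib-+ {n} _ _ ⟩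
          sum (λ v → k * k * two v) + sum (λ v → e * 𝟙 (thin E v))
            ≡⟨ cong₂ _+_ (*-distribˡ-sum {n} (k * k) two) (*-distribˡ-sum {n} e _) ⟨
          k * k * #ind 2 E + e * card (thin E)
            ≤⟨ +-monoʳ-≤ _ (*-monoʳ-≤ e (≤-trans (few-thin E) (m≤m*n k k {{>-nonZero 1≤k}}))) ⟩
          k * k * #ind 2 E + e * (k * k)                ≡⟨ cong (k * k * #ind 2 E +_) (*-comm e (k * k)) ⟩
          k * k * #ind 2 E + k * k * e                  ≡⟨ *-distribˡ-+ (k * k) _ e ⟨
          k * k * (#ind 2 E + e)
            ≡⟨ cong (λ z → k * k * (#ind 2 E + z)) (#ind1 E) ⟨
          k * k * (#ind 2 E + #ind 1 E)                 ∎
      where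
      open ≤-Reasoning
      e = card E
      two : Fin n → ℕ
      two v = 𝟙 (E v) * #ind 1 (E ∩ Non v)
      pointwise : ∀ v → 𝟙 (E v) * e ≤ k * k * two v + e * 𝟙 (thin E v)
      pointwise v with E v
      ... | false = z≤n
      ... | true with k * k ≤? e
      ...   | no kk≰ = contradiction kk≤ kk≰
      ...   | yes _ with k * k * card (E ∩ Non v) <? e
      ...     | yes _ = ≤-trans (≤-reflexive (*-comm 1 e)) (m≤n+m _ _)
      ...     | no ≮e = begin
          1 * e                                 ≡⟨ *-identityˡ e ⟩
          e                                     ≤⟨ ≮⇒≥ ≮e ⟩
          k * k * card (E ∩ Non v)              ≡⟨ cong (k * k *_) (trans (*-identityˡ _) (#ind1 (E ∩ Non v))) ⟨
          k * k * (1 * #ind 1 (E ∩ Non v))      ≤⟨ m≤m+n _ _ ⟩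
          k * k * (1 * #ind 1 (E ∩ Non v)) + e * 0 ∎

    extensions : Sub n → Vec (Fin n) p → Sub n
    extensions U []      = U
    extensions U (v ∷ x) = extensions (U ∩ Non v) x

    #ind-+ : ∀ i j U → #ind (i + j) U ≡ ∑ind i U (λ x → #ind j (extensions U x))
    #ind-+ zero    j U = refl
    #ind-+ (suc i) j U = sum-cong-≗ (λ v → cong (𝟙 (U v) *_) (#ind-+ i j (U ∩ Non v)))

    2ab≤a²+b² : ∀ a b → 2 * (a * b) ≤ a * a + b * b
    2ab≤a²+b² a b with ≤-total a b
    ... | inj₁ a≤b with _ , refl ← m≤n⇒∃[o]m+o≡n a≤b = ≤-trans (m≤m+n _ _) (≤-reflexive (expand a _))
      where
      expand : ∀ a d → 2 * (a * (a + d)) + d * d ≡ a * a + (a + d) * (a + d)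
      expand = solve-∀
    ... | inj₂ b≤a with _ , refl ← m≤n⇒∃[o]m+o≡n b≤a = ≤-trans (m≤m+n _ _) (≤-reflexive (expand b _))
      where
      expand : ∀ b d → 2 * ((b + d) * b) + d * d ≡ (b + d) * (b + d) + b * b
      expand = solve-∀

    -- Cauchy–Schwarz for the numbers of extensions, linearised at t.
    #ind-ratio : ∀ i t U → t * #ind i U ≤ #ind (suc i) U →
                 t * #ind (suc i) U ≤ k * k * (#ind (suc (suc i)) U + #ind (suc i) U)
    #ind-ratio i t U ratio = +-cancelˡ-≤ (t * I₁) _ _ (begin
      t * I₁ + t * I₁                                     ≡⟨ double t I₁ ⟩
      2 * t * I₁                                          ≡⟨ cong (2 * t *_) eq₁ ⟩
      2 * t * ∑ind i U (λ x → card (ext x))               ≡⟨ ∑ind-* {i} U (2 * t) _ ⟨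
      ∑ind i U (λ x → 2 * t * card (ext x))               ≤⟨ ∑ind-mono {i} (λ _ e → e) pointwise ⟩
      ∑ind i U (λ x → t * t + k * k * (#ind 2 (ext x) + #ind 1 (ext x)))
        ≡⟨ ∑ind-+ {i} U _ _ ⟩
      ∑ind i U (λ x → t * t) + ∑ind i U (λ x → k * k * (#ind 2 (ext x) + #ind 1 (ext x)))
        ≡⟨ cong₂ _+_ (∑ind-const {i} U (t * t)) (trans (∑ind-* {i} U (k * k) _)
             (cong (k * k *_) (trans (∑ind-+ {i} U _ _) (≡-sym (cong₂ _+_ (eq 2) (eq 1)))))) ⟩
      t * t * #ind i U + k * k * (#ind (i + 2) U + #ind (i + 1) U)
        ≡⟨ cong₂ (λ a b → t * t * #ind i U + k * k * (#ind a U + #ind b U)) (+-comm i 2) (+-comm i 1) ⟩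
      t * t * #ind i U + k * k * (#ind (suc (suc i)) U + I₁)
        ≤⟨ +-monoˡ-≤ _ (≤-trans (≤-reflexive (*-assoc t t _)) (*-monoʳ-≤ t ratio)) ⟩
      t * I₁ + k * k * (#ind (suc (suc i)) U + I₁)        ∎)
      where
      open ≤-Reasoning
      I₁ = #ind (suc i) U
      ext : Vec (Fin n) i → Sub n
      ext = extensions U
      eq : ∀ j → #ind (i + j) U ≡ ∑ind i U (λ x → #ind j (ext x))
      eq j = #ind-+ i j U
      ∑ind-cong : {F F′ : Vec (Fin n) i → ℕ} → (∀ x → F x ≡ F′ x) → ∑ind i U F ≡ ∑ind i U F′
      ∑ind-cong F≡F′ = ≤-antisym (∑ind-mono {i} (λ _ e → e) (λ x → ≤-reflexive (F≡F′ x)))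
                                 (∑ind-mono {i} (λ _ e → e) (λ x → ≤-reflexive (≡-sym (F≡F′ x))))
      eq₁ : I₁ ≡ ∑ind i U (λ x → card (ext x))
      eq₁ = trans (cong (λ j → #ind j U) (+-comm 1 i)) (trans (eq 1) (∑ind-cong (λ x → #ind1 (ext x))))
      pointwise : ∀ x → 2 * t * card (ext x) ≤ t * t + k * k * (#ind 2 (ext x) + #ind 1 (ext x))
      pointwise x = ≤-trans (≤-reflexive (*-assoc 2 t _))
        (≤-trans (2ab≤a²+b² t (card (ext x))) (+-monoʳ-≤ (t * t) (card²≤#ind (ext x))))
      double : ∀ t a → t * a + t * a ≡ 2 * t * a
      double = solve-∀

    k^-pos : ∀ e → 1 ≤ k ^ e
    k^-pos e = m^n>0 k {{>-nonZero 1≤k}} e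

    -- Passing from `i` to `suc i` lowers the ratio by `k³`: `#ind-ratio` loses `k²`, and one more
    -- `k`, at least 2, absorbs its extra summand `#ind (suc i) U`.
    #ind-growth : ∀ i τ U → k ^ (3 * i + τ) ≤ card U → k ^ τ * #ind i U ≤ #ind (suc i) U
    #ind-growth zero τ U big = ≤-trans (≤-reflexive (*-identityʳ (k ^ τ)))
      (≤-trans big (≤-reflexive (≡-sym (#ind1 U))))
    #ind-growth (suc i) τ U big = +-cancelʳ-≤ I₁ _ _ (begin
      k ^ τ * I₁ + I₁
        ≤⟨ +-monoʳ-≤ (k ^ τ * I₁) (m≤n*m I₁ (k ^ τ) {{>-nonZero (k^-pos τ)}}) ⟩
      k ^ τ * I₁ + k ^ τ * I₁
        ≡⟨ double (k ^ τ * I₁) ⟩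
      2 * (k ^ τ * I₁)
        ≤⟨ *-monoˡ-≤ (k ^ τ * I₁) (≤-trans (s≤s (s≤s z≤n)) 4≤k) ⟩
      k * (k ^ τ * I₁)
        ≤⟨ *-cancelˡ-≤ (k * k) {{>-nonZero (*-mono-≤ 1≤k 1≤k)}}
             (≤-trans (≤-reflexive (factor k (k ^ τ) I₁))
               (#ind-ratio i (k ^ (3 + τ)) U
                 (#ind-growth i (3 + τ) U (≤-trans (≤-reflexive (cong (k ^_) (exponent i τ))) big)))) ⟩
      #ind (suc (suc i)) U + I₁ ∎)
      where
      open ≤-Reasoning
      I₁ = #ind (suc i) U
      double : ∀ x → x + x ≡ 2 * x
      double = solve-∀
      factor : ∀ k t a → k * k * (k * (t * a)) ≡ k * (k * (k * t)) * a
      factor = solve-∀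
      exponent : ∀ i τ → 3 * i + (3 + τ) ≡ 3 * suc i + τ
      exponent = solve-∀

    #ind-pos : ∀ i τ U → k ^ (3 * i + τ) ≤ card U → 1 ≤ #ind i U
    #ind-pos zero    τ U big = ≤-refl
    #ind-pos (suc i) τ U big = ≤-trans
      (*-mono-≤ (k^-pos (3 + τ)) (#ind-pos i (3 + τ) U big′)) (#ind-growth i (3 + τ) U big′)
      where
      exponent : ∀ i τ → 3 * i + (3 + τ) ≡ 3 * suc i + τ
      exponent = solve-∀
      big′ = ≤-trans (≤-reflexive (cong (k ^_) (exponent i τ))) big

    -- Adjacency patterns

    -- Using `Non` for `false` makes both sides exclude `v`, so matching a pattern also gives
    -- distinctness from the entries of the tuple.
    side : Bool → Fin n → Sub n
    side true  = Nb
    side false = Non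

    side⇒ : ∀ b {v w} → side b v w ≡ true → adj G v w ≡ b × v ≢ w
    side⇒ false e = Non⇒ e
    side⇒ true {v} e = e , λ { refl → contradiction (trans (≡-sym e) (irrefl G v)) λ () }

    matches : Vec Bool p → Vec (Fin n) p → Sub n
    matches []      []      w = true
    matches (b ∷ π) (v ∷ x) w = side b v w ∧ matches π x w

    required : Vec Bool p → Vec (Fin n) p → Sub n
    required []          []      w = true
    required (true ∷ π)  (v ∷ x) w = adj G v w ∧ required π x w
    required (false ∷ π) (v ∷ x) w = required π x w

    -- The non-adjacencies prescribed by π are imposed one at a time, starting from
    -- the candidates that satisfy all the prescribed adjacencies; this counts the
    -- entries of x at which too many candidates are lost.  The set in which the
    -- entry v must not be thin does not depend on v.
    #losses : Sub n → Vec Bool p → Vec (Fin n) p → ℕ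
    #losses D []      []      = 0
    #losses D (b ∷ π) (v ∷ x) =
      (if b then 0 else 𝟙 (thin (D ∩ required π x) v)) + #losses (D ∩ side b v) π x

    -- For p = 0 the junk value p ∸ 1 = 0 is harmless.
    ∑ind-#losses : ∀ p (D : Sub n) (π : Vec Bool p) (U : Sub n) →
                   ∑ind p U (#losses D π) ≤ p * k * #ind (p ∸ 1) U
    ∑ind-#losses zero    D []      U = z≤n
    ∑ind-#losses (suc p) D (b ∷ π) U = begin
      ∑ind (suc p) U (#losses D (b ∷ π))
        ≤⟨ sum-mono pointwise ⟩
      sum (λ v → ∑ind p U (here v) + p * k * (𝟙 (U v) * #ind (p ∸ 1) (U ∩ Non v)))
        ≡⟨ ∑-distrib-+ {n} _ _ ⟩
      sum (λ v → ∑ind p U (here v)) + sum (λ v → p * k * (𝟙 (U v) * #ind (p ∸ 1) (U ∩ Non v)))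
        ≡⟨ cong₂ _+_ (∑ind-sum {p} U here) (*-distribˡ-sum {n} (p * k) _) ⟨
      ∑ind p U (λ x → card (thin (D ∩ required π x))) + p * k * sum (λ v → 𝟙 (U v) * #ind (p ∸ 1) (U ∩ Non v))
        -- For fixed later entries `x`, at most `k` values of the first entry are thin.
        ≤⟨ +-mono-≤ (≤-trans (∑ind-mono {p} (λ _ e → e) (λ x → few-thin (D ∩ required π x)))
                             (≤-reflexive (∑ind-const {p} U k)))
                    (refold p) ⟩
      k * #ind p U + p * k * #ind p U
        ≡⟨ *-distribʳ-+ (#ind p U) k (p * k) ⟨
      suc p * k * #ind p U ∎
      where
      open ≤-Reasoning
      here : Fin n → Vec (Fin n) p → ℕ
      here v x = 𝟙 (thin (D ∩ required π x) v)
      at-most-here : ∀ b v x → (if b then 0 else here v x) ≤ here v x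
      at-most-here true  v x = z≤n
      at-most-here false v x = ≤-refl
      pointwise : ∀ v →
        𝟙 (U v) * ∑ind p (U ∩ Non v) (λ x → #losses D (b ∷ π) (v ∷ x)) ≤
        ∑ind p U (here v) + p * k * (𝟙 (U v) * #ind (p ∸ 1) (U ∩ Non v))
      pointwise v = begin
        𝟙 (U v) * ∑ind p (U ∩ Non v) (λ x → #losses D (b ∷ π) (v ∷ x))
          ≤⟨ *-monoʳ-≤ (𝟙 (U v)) (∑ind-mono {p} (λ _ e → e)
               (λ x → +-monoˡ-≤ (#losses (D ∩ side b v) π x) (at-most-here b v x))) ⟩
        𝟙 (U v) * ∑ind p (U ∩ Non v) (λ x → here v x + #losses (D ∩ side b v) π x)
          ≡⟨ cong (𝟙 (U v) *_) (∑ind-+ {p} (U ∩ Non v) (here v) _) ⟩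
        𝟙 (U v) * (∑ind p (U ∩ Non v) (here v) + ∑ind p (U ∩ Non v) (#losses (D ∩ side b v) π))
          -- Enlarging `U ∩ Non v` to `U` in the first term frees the range of `x` from `v`; the
          -- sums over `v` and `x` can then be exchanged.
          ≤⟨ *-monoʳ-≤ (𝟙 (U v)) (+-mono-≤
               (∑ind-mono {p} {U ∩ Non v} {U} (λ w e → proj₁ (∧-elim (U w) e)) (λ _ → ≤-refl))
               (∑ind-#losses p (D ∩ side b v) π (U ∩ Non v))) ⟩
        𝟙 (U v) * (∑ind p U (here v) + p * k * #ind (p ∸ 1) (U ∩ Non v))
          ≡⟨ expand (𝟙 (U v)) (∑ind p U (here v)) (p * k) _ ⟩
        𝟙 (U v) * ∑ind p U (here v) + p * k * (𝟙 (U v) * #ind (p ∸ 1) (U ∩ Non v))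
          ≤⟨ +-monoˡ-≤ _ (≤-trans (*-monoˡ-≤ _ (𝟙≤1 (U v))) (≤-reflexive (*-identityˡ _))) ⟩
        ∑ind p U (here v) + p * k * (𝟙 (U v) * #ind (p ∸ 1) (U ∩ Non v)) ∎
        where
        expand : ∀ u a q c → u * (a + q * c) ≡ u * a + q * (u * c)
        expand = solve-∀
      refold : ∀ p → p * k * sum (λ v → 𝟙 (U v) * #ind (p ∸ 1) (U ∩ Non v)) ≤ p * k * #ind p U
      refold zero    = z≤n
      refold (suc p) = ≤-refl

    -- `D` records the entries already treated and `required` the adjacencies still ahead. A `true`
    -- entry only moves from the latter to the former, without shrinking the set; a `false` entry
    -- that is not thin costs `k²`.
    no-losses⇒many-matches : ∀ e D (π : Vec Bool p) x → #losses D π x ≡ 0 →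
      k ^ (2 * p + e) ≤ card (D ∩ required π x) → k ^ e ≤ card (D ∩ matches π x)
    no-losses⇒many-matches e D [] [] _ big = big
    no-losses⇒many-matches {suc p} e D (true ∷ π) (v ∷ x) none big = ≤-trans
      (no-losses⇒many-matches e (D ∩ Nb v) π x none
        (≤-trans (^-monoʳ-≤ k {{>-nonZero 1≤k}} (+-monoˡ-≤ e (*-monoʳ-≤ 2 (n≤1+n p))))
          (≤-trans big (card-mono {S = D ∩ required (true ∷ π) (v ∷ x)} {(D ∩ Nb v) ∩ required π x} (λ w m →
            let d , r = ∧-elim (D w) m
                a , s = ∧-elim (adj G v w) r
            in ∧-intro (∧-intro d a) s)))))
      (card-mono {S = (D ∩ Nb v) ∩ matches π x} {D ∩ matches (true ∷ π) (v ∷ x)} (λ w m →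
        let da , s = ∧-elim (D w ∧ adj G v w) m
            d , a  = ∧-elim (D w) da
        in ∧-intro d (∧-intro a s)))
    no-losses⇒many-matches {suc p} e D (false ∷ π) (v ∷ x) none big
      with thin (D ∩ required π x) v in not-thin
    ... | false = ≤-trans
      (no-losses⇒many-matches e (D ∩ Non v) π x none (≤-trans
        (¬thin⇒ (D ∩ required π x) (2 * p + e) not-thin
          (≤-trans (≤-reflexive (cong (k ^_) (exponent p e))) big))
        (card-mono {S = (D ∩ required π x) ∩ Non v} {(D ∩ Non v) ∩ required π x}
          (∩-swapʳ D (required π x) (Non v)))))
      (card-mono {S = (D ∩ Non v) ∩ matches π x} {D ∩ matches (false ∷ π) (v ∷ x)} (λ w m →
        let da , s = ∧-elim (D w ∧ Non v w) m
            d , a  = ∧-elim (D w) da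
        in ∧-intro d (∧-intro a s)))
      where
      exponent : ∀ p e → 2 + (2 * p + e) ≡ 2 * suc p + e
      exponent = solve-∀

    common⊆required : (π : Vec Bool p) (x : Vec (Fin n) p) → common x ⊆ required π x
    common⊆required []          []      w e = refl
    common⊆required (true ∷ π)  (v ∷ x) w e =
      let a , r = ∧-elim (adj G w v) e
      in ∧-intro (trans (Graph.sym G v w) a) (common⊆required π x w r)
    common⊆required (false ∷ π) (v ∷ x) w e =
      common⊆required π x w (proj₂ (∧-elim (adj G w v) e))

    matches⇒ : (π : Vec Bool p) (x : Vec (Fin n) p) → ∀ {w} → matches π x w ≡ true →
               ∀ i → adj G (lookup x i) w ≡ lookup π i × lookup x i ≢ w
    matches⇒ (b ∷ π) (v ∷ x) {w} m zero    = side⇒ b (proj₁ (∧-elim (side b v w) m))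
    matches⇒ (b ∷ π) (v ∷ x) {w} m (suc i) = matches⇒ π x (proj₂ (∧-elim (side b v w) m)) i

    -- Pairwise non-adjacent families and the embedding of `H`

    PairwiseNon : (Fin p → Fin n) → Set
    PairwiseNon f = ∀ i j → i ≢ j → adj G (f i) (f j) ≡ false × f i ≢ f j

    cons : Fin n → (Fin p → Fin n) → Fin (suc p) → Fin n
    cons v f zero    = v
    cons v f (suc i) = f i

    cons-PairwiseNon : ∀ {v} {f : Fin p → Fin n} → (∀ i → Non v (f i) ≡ true) →
                       PairwiseNon f → PairwiseNon (cons v f)
    cons-PairwiseNon v-f ff zero    zero    i≢j = contradiction refl i≢j
    cons-PairwiseNon v-f ff zero    (suc j) _   = Non⇒ (v-f j)
    cons-PairwiseNon {v = v} {f} v-f ff (suc i) zero _ =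
      let a , v≢ = Non⇒ (v-f i) in trans (Graph.sym G (f i) v) a , v≢ ∘ ≡-sym
    cons-PairwiseNon v-f ff (suc i) (suc j) i≢j = ff i j (i≢j ∘ cong suc)

    IndepIn⇒∈ : ∀ U (x : Vec (Fin n) p) → IndepIn U x → ∀ i → U (lookup x i) ≡ true
    IndepIn⇒∈ U (v ∷ x) (v∈ , _)   zero    = v∈
    IndepIn⇒∈ U (v ∷ x) (_  , ind) (suc i) =
      proj₁ (∧-elim (U (lookup x i)) (IndepIn⇒∈ (U ∩ Non v) x ind i))

    IndepIn⇒PairwiseNon : ∀ U (x : Vec (Fin n) p) → IndepIn U x → PairwiseNon (lookup x)
    IndepIn⇒PairwiseNon U (v ∷ x) (_ , ind) zero zero i≢j = contradiction refl i≢j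
    IndepIn⇒PairwiseNon U (v ∷ x) (v∈ , ind) (suc i) (suc j) i≢j =
      IndepIn⇒PairwiseNon (U ∩ Non v) x ind i j (i≢j ∘ cong suc)
    IndepIn⇒PairwiseNon U (v ∷ x) (v∈ , ind) zero (suc j) _ =
      Non⇒ (proj₂ (∧-elim (U (lookup x j)) (IndepIn⇒∈ (U ∩ Non v) x ind j)))
    IndepIn⇒PairwiseNon U (v ∷ x) (v∈ , ind) (suc i) zero _ =
      let a , v≢ = Non⇒ (proj₂ (∧-elim (U (lookup x i)) (IndepIn⇒∈ (U ∩ Non v) x ind i)))
      in trans (Graph.sym G (lookup x i) v) a , v≢ ∘ ≡-sym

    -- The sets `C j` have at most `q * k < card B` thin vertices in total, so some vertex has a
    -- smaller thin count than its indicator in `B`: it lies in `B` and is thin for no `C j`.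
    thick-vertex : ∀ q (B : Sub n) (C : Fin q → Sub n) → q < k → k * k ≤ card B →
                   ∃[ v ] B v ≡ true × (∀ j → thin (C j) v ≡ false)
    thick-vertex q B C q<k big =
      let v , lt = sum-<⇒∃ {n} {#thin} {λ v → 𝟙 (B v)} few
      in v , <𝟙⇒true lt , λ j → 𝟙<1⇒false
           (≤-<-trans (term≤sum (λ j → 𝟙 (thin (C j) v)) j) (<-≤-trans lt (𝟙≤1 (B v))))
      where
      open ≤-Reasoning
      #thin : Fin n → ℕ
      #thin v = sum (λ j → 𝟙 (thin (C j) v))
      few : sum #thin < card B
      few = begin-strict
        sum #thin                      ≡⟨ card-sum (λ j → thin (C j)) ⟩
        sum (λ j → card (thin (C j)))  ≤⟨ sum-mono (λ j → few-thin (C j)) ⟩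
        sum {q} (λ _ → k)              ≡⟨ sum-const q k ⟩
        q * k                          <⟨ *-monoˡ-< k {{>-nonZero 1≤k}} q<k ⟩
        k * k                          ≤⟨ big ⟩
        card B                         ∎

    transversal-exponent : ∀ q → 2 + (2 + 2 * q) ≡ 2 + 2 * suc q
    transversal-exponent = solve-∀

    -- Greedy choice: a vertex of the first set that is thin for no later one costs each of these a
    -- factor `k²`. The exponent pays for `q` such choices and still leaves `k²` candidates.
    independent-transversal : ∀ q (C : Fin q → Sub n) → q ≤ k →
      (∀ j → k ^ (2 + 2 * q) ≤ card (C j)) →
      Σ (Fin q → Fin n) λ b → (∀ j → C j (b j) ≡ true) × PairwiseNon b
    independent-transversal zero    C _   _   = (λ ()) , (λ ()) , λ ()
    independent-transversal (suc q) C q<k big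
      with v , v∈ , not-thin ← thick-vertex q (C zero) (C ∘ suc) q<k (≤-trans
             (*-monoʳ-≤ k (m≤m*n k (k ^ (2 * suc q)) {{>-nonZero (k^-pos (2 * suc q))}})) (big zero))
      with b , b∈ , bb ← independent-transversal q (λ j → C (suc j) ∩ Non v) (<⇒≤ q<k)
             (λ j → ¬thin⇒ (C (suc j)) (2 + 2 * q) (not-thin j)
               (≤-trans (≤-reflexive (cong (k ^_) (transversal-exponent q))) (big (suc j))))
      = cons v b , (λ { zero → v∈ ; (suc j) → proj₁ (∧-elim (C (suc j) (b j)) (b∈ j)) }) ,
        cons-PairwiseNon (λ j → proj₂ (∧-elim (C (suc j) (b j)) (b∈ j))) bb

    -- First moment: no tuple is poor, and the losses over all patterns total at most
    -- `(suc h)² * k * #ind h U`, less than `k³ * #ind h U` and so less than the number of tuples.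
    -- Hence some tuple has none.
    lossless-tuple : ∀ h s (U : Sub n) (π : Fin (suc h) → Vec Bool (suc h)) → suc h < k →
      DependentRandomChoice.#poor s (suc h) U ≡ 0 → k ^ (3 * h + 3) ≤ card U →
      ∃[ x ] IndepIn U x × s ≤ card (common x) × (∀ j → #losses full (π j) x ≡ 0)
    lossless-tuple h s U π h<k no-poor big =
      let x , ind , F<1 = ∑ind-<⇒∃ {suc h} U {λ x → poor x + losses x} {λ _ → 1} few
          F≡0 = n<1⇒n≡0 F<1
      in x , ind , rich x (m+n≡0⇒m≡0 (poor x) F≡0) ,
         λ j → n≤0⇒n≡0 (≤-trans (term≤sum (λ j → #losses full (π j) x) j)
                                (≤-reflexive (m+n≡0⇒n≡0 (poor x) F≡0)))
      where
      open DependentRandomChoice s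
      open ≤-Reasoning
      rich : (x : Vec (Fin n) (suc h)) → poor x ≡ 0 → s ≤ card (common x)
      rich x eq with card (common x) <? s
      ... | no c≮s = ≮⇒≥ c≮s
      losses : Vec (Fin n) (suc h) → ℕ
      losses x = sum (λ j → #losses full (π j) x)
      cube : ∀ k a → k * (k * k * a) ≡ k * (k * (k * 1)) * a
      cube = solve-∀
      few : ∑ind (suc h) U (λ x → poor x + losses x) < #ind (suc h) U
      few = begin-strict
        ∑ind (suc h) U (λ x → poor x + losses x)
          ≡⟨ ∑ind-+ {suc h} U poor losses ⟩
        #poor (suc h) U + ∑ind (suc h) U losses
          ≡⟨ cong₂ _+_ no-poor (∑ind-sum {suc h} U (λ j → #losses full (π j))) ⟩
        sum (λ j → ∑ind (suc h) U (#losses full (π j)))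
          ≤⟨ sum-mono (λ j → ∑ind-#losses (suc h) full (π j) U) ⟩
        sum {suc h} (λ _ → suc h * k * #ind h U)
          ≡⟨ sum-const (suc h) _ ⟩
        suc h * (suc h * k * #ind h U)
          ≤⟨ *-monoʳ-≤ (suc h) (*-monoˡ-≤ (#ind h U) (*-monoˡ-≤ k (<⇒≤ h<k))) ⟩
        suc h * (k * k * #ind h U)
          <⟨ *-monoˡ-< (k * k * #ind h U)
               {{>-nonZero (*-mono-≤ (*-mono-≤ 1≤k 1≤k) (#ind-pos h 3 U big))}} h<k ⟩
        k * (k * k * #ind h U)
          ≡⟨ cube k (#ind h U) ⟩
        k ^ 3 * #ind h U
          ≤⟨ #ind-growth h 3 U big ⟩
        #ind (suc h) U ∎

    -- Both x and b are indexed by all of H; each is used only on its own colour class.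
    induced-copy : ∀ {h} (H : Graph h) → Bipartite H → (x b : Fin h → Fin n) →
      PairwiseNon x → PairwiseNon b →
      (∀ i j → adj G (x i) (b j) ≡ adj H j i × x i ≢ b j) → InducedCopy H G
    induced-copy {h} H (col , proper) x b xx bb xb = f , inj , preserves
      where
      f : Fin h → Fin n
      f i = if col i then x i else b i
      same-colour : ∀ i j {c} → col i ≡ c → col j ≡ c → adj H i j ≡ false
      same-colour i j ci cj with adj H i j in eq
      ... | false = refl
      ... | true  = contradiction (trans ci (≡-sym cj)) (proper i j eq)
      distinct : ∀ i j → i ≢ j → adj G (f i) (f j) ≡ adj H i j × f i ≢ f j
      distinct i j i≢j with col i in ci | col j in cj
      ... | true  | true  = let a , ≢ = xx i j i≢j in trans a (≡-sym (same-colour i j ci cj)) , ≢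
      ... | false | false = let a , ≢ = bb i j i≢j in trans a (≡-sym (same-colour i j ci cj)) , ≢
      ... | true  | false = let a , ≢ = xb i j in trans a (Graph.sym H j i) , ≢
      ... | false | true  = let a , ≢ = xb j i in trans (Graph.sym G (b i) (x j)) a , ≢ ∘ ≡-sym
      inj : Injective _≡_ _≡_ f
      inj {i} {j} e with i ≟ j
      ... | yes i≡j = i≡j
      ... | no  i≢j = contradiction e (proj₂ (distinct i j i≢j))
      preserves : ∀ i j → adj G (f i) (f j) ≡ adj H i j
      preserves i j with i ≟ j
      ... | yes refl = trans (irrefl G (f i)) (≡-sym (irrefl H i))
      ... | no  i≢j  = proj₁ (distinct i j i≢j)

    k^-mono : ∀ {a b} c → a + c ≡ b → k ^ a ≤ k ^ b
    k^-mono {a} c refl = ^-monoʳ-≤ k {{>-nonZero 1≤k}} (m≤m+n a c)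

    embed : ∀ h (H : Graph (suc h)) → Bipartite H → suc h < k → (U : Sub n) →
      DependentRandomChoice.#poor (k ^ (8 * suc h)) (suc h) U ≡ 0 → k ^ (8 * suc h) ≤ card U →
      InducedCopy H G
    embed h H bip h<k U no-poor big =
      let x , ind , rich , lossless = lossless-tuple h (k ^ (8 * suc h)) U π h<k no-poor
            (≤-trans (k^-mono (5 + 5 * h) (e₁ h)) big)
          b , b∈ , bb = independent-transversal (suc h) (λ j → matches (π j) x) (<⇒≤ h<k) (λ j →
            -- Of the exponent `8 * suc h`, up to `2 * suc h` is spent on non-adjacencies to `x`,
            -- and `2 + 2 * suc h` is kept for the transversal.
            no-losses⇒many-matches (2 + 2 * suc h) full (π j) x (lossless j)
              (≤-trans (k^-mono (2 + 4 * h) (e₂ h))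
                (≤-trans rich (card-mono {S = common x} {required (π j) x} (common⊆required (π j) x)))))
      in induced-copy H bip (lookup x) b (IndepIn⇒PairwiseNon U x ind) bb
           (λ i j → let a , ≢ = matches⇒ (π j) x (b∈ j) i
                    in trans a (lookup∘tabulate (adj H j) i) , ≢)
      where
      π : Fin (suc h) → Vec Bool (suc h)
      π j = tabulate (adj H j)
      e₁ : ∀ h → 3 * h + 3 + (5 + 5 * h) ≡ 8 * suc h
      e₁ = solve-∀
      e₂ : ∀ h → 2 * suc h + (2 + 2 * suc h) + (2 + 4 * h) ≡ 8 * suc h
      e₂ = solve-∀

    -- High-degree vertices and the subset without poor tuples

    double≤k* : ∀ a → a + a ≤ k * a
    double≤k* a = ≤-trans (≤-reflexive (double a)) (*-monoˡ-≤ a (≤-trans (s≤s (s≤s z≤n)) 4≤k))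
      where
      double : ∀ a → a + a ≡ 2 * a
      double = solve-∀

    high : ℕ → Sub n
    high d v = ⌊ d ≤? card (Nb v) ⌋

    high-degree : ∀ d v → high d v ≡ true → d ≤ card (Nb v)
    high-degree d v e with yes d≤ ← d ≤? card (Nb v) = d≤

    -- With `k * d` vertices of degree below `d`, the greedy choice would give an independent
    -- `k`-set. So fewer than `k * d` of the `k * k * d` vertices have low degree.
    many-high : ∀ {d} → 1 ≤ d → n ≡ k * (k * d) → ¬ HasIndependentSet G k → k * d ≤ card (high d)
    many-high {d} 1≤d n≡ no-indep = +-cancelʳ-≤ (k * d) _ _ (begin
      k * d + k * d                 ≤⟨ double≤k* (k * d) ⟩
      k * (k * d)                   ≡⟨ n≡ ⟨
      n                             ≡⟨ card-full n ⟨
      card {n} full                 ≤⟨ card-split full (high d) ⟩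
      card (high d) + card low      ≤⟨ +-monoʳ-≤ (card (high d)) (<⇒≤ (≰⇒> λ kd≤low →
        let f , _ , inj , indep = greedy-independent k 1≤d low low-degree kd≤low
        in no-indep (f , inj , indep))) ⟩
      card (high d) + k * d         ∎)
      where
      open ≤-Reasoning
      low : Sub n
      low v = not (high d v)
      low-degree : ∀ v → low v ≡ true → card (Nb v) < d
      low-degree v e with no d≰ ← d ≤? card (Nb v) = ≰⇒> d≰

    -- The size term starts at no less than `2 * Y` and the poor term, by the condition on `σ`, at
    -- no more than `Y`; a surplus `Y` survives the `t` restrictions. The condition on `τ` says that
    -- `Y / n ^ t` is at least `k ^ τ`.
    rich-subset : ∀ h e t σ τ → n ≡ k ^ (2 + e) →
      2 + e + (σ * t + (2 + e) * h) ≤ e * t + e → (2 + e) * t + τ ≤ e * t + e →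
      ¬ HasIndependentSet G k →
      ∃[ U ] DependentRandomChoice.#poor (k ^ σ) h U ≡ 0 × k ^ τ ≤ card U
    rich-subset h e t σ τ n≡kkd σ-ok τ-ok no-indep =
      -- The weight `n` on poor tuples makes a single one outweigh any set, as `card U ≤ n`.
      let U , ineq = restrict h t (high d) 1 n 1≤n (high-degree d)
      in U , no-poor U (balance U ineq) , large U (balance U ineq)
      where
      open ≤-Reasoning
      d = k ^ e
      s = k ^ σ
      Y = k ^ (e * t + e)
      open DependentRandomChoice s

      1≤n : 1 ≤ n
      1≤n = ≤-trans (k^-pos (2 + e)) (≤-reflexive (≡-sym n≡kkd))

      lower : Y + Y ≤ 1 * (d ^ t * card (high d))
      lower = begin
        Y + Y                           ≤⟨ double≤k* Y ⟩
        k * Y                           ≡⟨ cong (k *_) (^-distribˡ-+-* k (e * t) e) ⟩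
        k * (k ^ (e * t) * d)           ≡⟨ reorder k (k ^ (e * t)) d ⟩
        1 * (k ^ (e * t) * (k * d))     ≡⟨ cong (λ z → 1 * (z * (k * d))) (^-*-assoc k e t) ⟨
        1 * (d ^ t * (k * d))
          ≤⟨ *-monoʳ-≤ 1 (*-monoʳ-≤ (d ^ t) (many-high (k^-pos e) n≡kkd no-indep)) ⟩
        1 * (d ^ t * card (high d))     ∎
        where
        reorder : ∀ k a d → k * (a * d) ≡ 1 * (a * (k * d))
        reorder = solve-∀

      upper : n * (s ^ t * #poor h (high d)) ≤ Y
      upper = begin
        n * (s ^ t * #poor h (high d))
          ≤⟨ *-monoʳ-≤ n (*-monoʳ-≤ (s ^ t) (≤-trans
               (∑ind-mono {h} {high d} {high d} {poor} {λ _ → 1} (λ _ m → m)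
                 (λ x → 𝟙≤1 ⌊ card (common x) <? s ⌋))
               (#ind≤n^p h (high d)))) ⟩
        n * (s ^ t * n ^ h)
          ≡⟨ cong (λ z → z * (s ^ t * z ^ h)) n≡kkd ⟩
        k ^ (2 + e) * (s ^ t * (k ^ (2 + e)) ^ h)
          ≡⟨ cong (k ^ (2 + e) *_) (cong₂ _*_ (^-*-assoc k σ t) (^-*-assoc k (2 + e) h)) ⟩
        k ^ (2 + e) * (k ^ (σ * t) * k ^ ((2 + e) * h))
          ≡⟨ cong (k ^ (2 + e) *_) (^-distribˡ-+-* k (σ * t) ((2 + e) * h)) ⟨
        k ^ (2 + e) * k ^ (σ * t + (2 + e) * h)
          ≡⟨ ^-distribˡ-+-* k (2 + e) (σ * t + (2 + e) * h) ⟨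
        k ^ (2 + e + (σ * t + (2 + e) * h))
          ≤⟨ ^-monoʳ-≤ k {{>-nonZero 1≤k}} σ-ok ⟩
        Y ∎

      module _ (U : Sub n) where

        P = #poor h U

        balance : 1 * (d ^ t * card (high d)) + n ^ t * n * P ≤
                  n * (s ^ t * #poor h (high d)) + n ^ t * 1 * card U →
                  Y + n ^ t * n * P ≤ n ^ t * card U
        balance ineq = +-cancelˡ-≤ Y _ _ (begin
          Y + (Y + n ^ t * n * P)                         ≡⟨ +-assoc Y Y _ ⟨
          Y + Y + n ^ t * n * P                           ≤⟨ +-monoˡ-≤ _ lower ⟩
          1 * (d ^ t * card (high d)) + n ^ t * n * P     ≤⟨ ineq ⟩
          n * (s ^ t * #poor h (high d)) + n ^ t * 1 * card U
            ≤⟨ +-mono-≤ upper (≤-reflexive (cong (_* card U) (*-identityʳ (n ^ t)))) ⟩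
          Y + n ^ t * card U                              ∎)

        no-poor : Y + n ^ t * n * P ≤ n ^ t * card U → P ≡ 0
        no-poor bal = n<1⇒n≡0 (≰⇒> λ 1≤P → <-irrefl refl (begin-strict
          n ^ t * n                  ≤⟨ m≤m*n (n ^ t * n) P {{>-nonZero 1≤P}} ⟩
          n ^ t * n * P              <⟨ +-monoˡ-< (n ^ t * n * P) (k^-pos (e * t + e)) ⟩
          Y + n ^ t * n * P          ≤⟨ bal ⟩
          n ^ t * card U             ≤⟨ *-monoʳ-≤ (n ^ t) (card≤n U) ⟩
          n ^ t * n                  ∎))

        large : Y + n ^ t * n * P ≤ n ^ t * card U → k ^ τ ≤ card U
        large bal = *-cancelˡ-≤ (n ^ t) {{>-nonZero (m^n>0 n {{>-nonZero 1≤n}} t)}} (begin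
          n ^ t * k ^ τ                 ≡⟨ cong (λ z → z ^ t * k ^ τ) n≡kkd ⟩
          (k ^ (2 + e)) ^ t * k ^ τ     ≡⟨ cong (_* k ^ τ) (^-*-assoc k (2 + e) t) ⟩
          k ^ ((2 + e) * t) * k ^ τ     ≡⟨ ^-distribˡ-+-* k ((2 + e) * t) τ ⟨
          k ^ ((2 + e) * t + τ)         ≤⟨ ^-monoʳ-≤ k {{>-nonZero 1≤k}} τ-ok ⟩
          Y                             ≤⟨ m≤m+n Y (n ^ t * n * P) ⟩
          Y + n ^ t * n * P             ≤⟨ bal ⟩
          n ^ t * card U                ∎)

    find-copy : ∀ h (H : Graph (suc h)) → Bipartite H → suc h < k → n ≡ k ^ (24 * suc h) →
                ¬ HasIndependentSet G k → InducedCopy H G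
    find-copy h H bip h<k n≡ no-indep =
      -- With `g = suc h` this takes `e = 24g - 2`, `t = 2g`, `σ = τ = 8g`. The conditions become
      -- `40g² + 24g` and `48g² + 8g` at most `48g² + 20g - 2`; the last summands on the left of
      -- `e₁` and `e₂` are the slack.
      let U , no-poor , large = rich-subset (suc h) (22 + 24 * h) (2 * suc h) (8 * suc h) (8 * suc h)
            (trans n≡ (cong (k ^_) (e₀ h)))
            (m+n≤o⇒m≤o _ (≤-reflexive (e₁ h)))
            (m+n≤o⇒m≤o _ (≤-reflexive (e₂ h)))
            no-indep
      in embed h H bip h<k U no-poor large
      where
      e₀ : ∀ h → 24 * suc h ≡ 2 + (22 + 24 * h)
      e₀ = solve-∀
      e₁ : ∀ h → 2 + (22 + 24 * h) + (8 * suc h * (2 * suc h) + (2 + (22 + 24 * h)) * suc h)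
                   + (2 + 12 * h + 8 * (h * h))
                 ≡ (22 + 24 * h) * (2 * suc h) + (22 + 24 * h)
      e₁ = solve-∀
      e₂ : ∀ h → (2 + (22 + 24 * h)) * (2 * suc h) + 8 * suc h + (10 + 12 * h)
                 ≡ (22 + 24 * h) * (2 * suc h) + (22 + 24 * h)
      e₂ = solve-∀

-- Decidability and the choice of k

-- Functions are searched through their codes in a finite set. Decoding a code returns the function
-- only up to pointwise equality, hence the condition that `P` respects it.
any-fun? : ∀ {m} {P : (Fin m → Fin n) → Set} →
           (∀ {f g} → (∀ i → f i ≡ g i) → P f → P g) → (∀ f → Dec (P f)) → Dec (Σ _ P)
any-fun? resp P? = map′
  (λ (i , Pi) → finToFun i , Pi)
  (λ (f , Pf) → funToFin f , resp (λ i → ≡-sym (finToFun-funToFin f i)) Pf)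
  (any? (λ i → P? (finToFun i)))

injective-resp : ∀ {m} {f g : Fin m → Fin n} → (∀ i → f i ≡ g i) →
                 Injective _≡_ _≡_ f → Injective _≡_ _≡_ g
injective-resp f≗g inj {x} {y} e = inj (trans (f≗g x) (trans e (≡-sym (f≗g y))))

injective? : ∀ {m} (f : Fin m → Fin n) → Dec (Injective _≡_ _≡_ f)
injective? f = map′ (λ h {x} {y} → h x y) (λ h x y → h {x} {y})
  (all? λ x → all? λ y → (f x ≟ f y) →-dec (x ≟ y))

hasIndependentSet? : (G : Graph n) (k : ℕ) → Dec (HasIndependentSet G k)
hasIndependentSet? G k = any-fun?
  (λ f≗g (inj , ind) → injective-resp f≗g inj ,
     λ i j → trans (≡-sym (cong₂ (adj G) (f≗g i) (f≗g j))) (ind i j))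
  (λ f → injective? f ×-dec all? λ i → all? λ j → adj G (f i) (f j) ≟ᵇ false)

hasKmm? : (G : Graph n) (m : ℕ) → Dec (HasKmm G m)
hasKmm? G m = any-fun?
  (λ f≗g (b , inj-a , inj-b , cross) → b , injective-resp f≗g inj-a , inj-b ,
     λ i j → trans (cong (λ v → adj G v (b j)) (≡-sym (f≗g i))) (cross i j))
  (λ a → any-fun?
    (λ f≗g (inj-a , inj-b , cross) → inj-a , injective-resp f≗g inj-b ,
       λ i j → trans (cong (adj G (a i)) (≡-sym (f≗g j))) (cross i j))
    (λ b → injective? a ×-dec injective? b ×-dec
           all? λ i → all? λ j → adj G (a i) (b j) ≟ᵇ true))

-- Induction on `n` upwards from `k₀ ^ e`: the root grows by at most one when `n` does.
integer-root : ∀ k₀ e .{{_ : NonZero e}} n → k₀ ^ e ≤ n →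
               ∃[ k ] k₀ ≤ k × k ^ e ≤ n × n < suc k ^ e
integer-root k₀ e n k₀^≤n with k₀ ^ e ≟ⁿ n
... | yes refl = k₀ , ≤-refl , ≤-refl , ^-monoˡ-< e (n<1+n k₀)
integer-root k₀ e zero k₀^≤n | no ≢n = contradiction (n≤0⇒n≡0 k₀^≤n) ≢n
integer-root k₀ e (suc n) k₀^≤n | no ≢n
  with k , k₀≤k , k^≤n , n<k+1^ ← integer-root k₀ e n (≤-pred (≤∧≢⇒< k₀^≤n ≢n))
  with suc n <? suc k ^ e
... | yes n+1< = k , k₀≤k , m≤n⇒m≤1+n k^≤n , n+1<
-- Here `suc n` equals `suc k ^ e`, which is below the next power.
... | no  n+1≮ = suc k , m≤n⇒m≤1+n k₀≤k , ≮⇒≥ n+1≮ ,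
                 ≤-<-trans n<k+1^ (^-monoˡ-< e (n<1+n (suc k)))

-- Passing to an initial subgraph

initial-subgraph : ∀ {m} → m ≤ n → Graph n → Graph m
initial-subgraph m≤n G = record
  { adj    = λ i j → adj G (inject≤ i m≤n) (inject≤ j m≤n)
  ; sym    = λ i j → Graph.sym G (inject≤ i m≤n) (inject≤ j m≤n)
  ; irrefl = λ i → irrefl G (inject≤ i m≤n)
  }

module _ {m} (m≤n : m ≤ n) (G : Graph n) where

  private
    ι : Fin m → Fin n
    ι i = inject≤ i m≤n

    ι-injective : Injective _≡_ _≡_ ι
    ι-injective = inject≤-injective m≤n m≤n _ _

  lift-independent : ∀ {k} → HasIndependentSet (initial-subgraph m≤n G) k → HasIndependentSet G k
  lift-independent (f , inj , ind) = ι ∘ f , inj ∘ ι-injective , ind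

  lift-Kmm : ∀ {k} → HasKmm (initial-subgraph m≤n G) k → HasKmm G k
  lift-Kmm (a , b , inj-a , inj-b , cross) =
    ι ∘ a , ι ∘ b , inj-a ∘ ι-injective , inj-b ∘ ι-injective , cross

  lift-copy : ∀ {h} {H : Graph h} → InducedCopy H (initial-subgraph m≤n G) → InducedCopy H G
  lift-copy (f , inj , preserves) = ι ∘ f , inj ∘ ι-injective , preserves

-- The initial subgraph has exactly `k ^ (24 * suc h)` vertices. Deciding both alternatives in `G`
-- makes the argument by contradiction constructive.
independent⊎Kmm : ∀ h (H : Graph (suc h)) → Bipartite H → ∀ k → 4 ≤ k → suc h < k →
  k ^ (24 * suc h) ≤ n → (G : Graph n) → ¬ InducedCopy H G →
  HasIndependentSet G k ⊎ HasKmm G k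
independent⊎Kmm h H bip k 4≤k h<k k^≤n G no-H with hasIndependentSet? G k | hasKmm? G k
... | yes ind    | _       = inj₁ ind
... | no  _      | yes Kkk = inj₂ Kkk
... | no  no-ind | no no-Kkk = contradiction
  (lift-copy k^≤n G {H = H} (Tuples.NoLargeBiclique.find-copy (initial-subgraph k^≤n G) k 4≤k
    (no-Kkk ∘ lift-Kmm k^≤n G) h H bip h<k refl (no-ind ∘ lift-independent k^≤n G)))
  no-H

theorem1p8 : ∃[ p ] ∃[ q ] (1 ≤ p × 1 ≤ q ×
    (∀ h (H : Graph h) → Bipartite H →
    ∃[ N ] (∀ n → N ≤ n → (G : Graph n) → ¬ InducedCopy H G →
    (∃[ k ] (n ^ p ≤ k ^ (q * h) × HasIndependentSet G k))
    ⊎ (∃[ m ] (n ^ p ≤ m ^ (q * h) × HasKmm G m)))))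
-- The constant is `c = 1/48`: `k` is the rounded-down root of order `24 * h`, and the rounding is
-- paid for by `suc k ≤ k ^ 2`, which doubles the exponent.
theorem1p8 = 1 , 48 , ≤-refl , s≤s z≤n , bound
  where
  size-bound : ∀ n k h → 4 ≤ k → n < suc k ^ (24 * h) → n ^ 1 ≤ k ^ (48 * h)
  size-bound n k h 4≤k n< = begin
    n ^ 1               ≡⟨ ^-identityʳ n ⟩
    n                   ≤⟨ <⇒≤ n< ⟩
    suc k ^ (24 * h)    ≤⟨ ^-monoˡ-≤ (24 * h) (+-monoˡ-≤ k (≤-trans (s≤s z≤n) 4≤k)) ⟩
    (k + k) ^ (24 * h)  ≤⟨ ^-monoˡ-≤ (24 * h) (+-monoʳ-≤ k (m≤m+n k 0)) ⟩
    (2 * k) ^ (24 * h)  ≤⟨ ^-monoˡ-≤ (24 * h) (*-monoˡ-≤ k (≤-trans (s≤s (s≤s z≤n)) 4≤k)) ⟩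
    (k * k) ^ (24 * h)  ≡⟨ cong (λ z → (k * z) ^ (24 * h)) (*-identityʳ k) ⟨
    (k ^ 2) ^ (24 * h)  ≡⟨ ^-*-assoc k 2 (24 * h) ⟩
    k ^ (2 * (24 * h))  ≡⟨ cong (k ^_) (*-assoc 2 24 h) ⟨
    k ^ (48 * h)        ∎
    where open ≤-Reasoning

  bound : ∀ h (H : Graph h) → Bipartite H →
    ∃[ N ] (∀ n → N ≤ n → (G : Graph n) → ¬ InducedCopy H G →
    (∃[ k ] (n ^ 1 ≤ k ^ (48 * h) × HasIndependentSet G k))
    ⊎ (∃[ m ] (n ^ 1 ≤ m ^ (48 * h) × HasKmm G m)))
  -- The empty graph is an induced subgraph of every `G`.
  bound zero    H bip = 0 , λ n _ G no-H → contradiction ((λ ()) , (λ {}) , λ ()) no-H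
  -- The base `4 + suc h` forces both `4 ≤ k` and `suc h < k`.
  bound (suc h) H bip = (4 + suc h) ^ (24 * suc h) , λ n N≤n G no-H →
    let k , k₀≤k , k^≤n , n<k+1^ = integer-root (4 + suc h) (24 * suc h) n N≤n
        4≤k  = ≤-trans (m≤m+n 4 (suc h)) k₀≤k
        h<k  = ≤-trans (m≤n+m (2 + h) 3) k₀≤k
        size = size-bound n k (suc h) 4≤k n<k+1^
    in map-⊎ (λ ind → k , size , ind) (λ Kkk → k , size , Kkk)
         (independent⊎Kmm h H bip k 4≤k h<k k^≤n G no-H)
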